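{- For every integer $n\geq 2$, the multipath complex $X(\mathtt{BP}_n)$ of the bidirectional polygonal digraph $\mathtt{BP}_n$ on $n+1$ vertices is not shellable.
   Context: A digraph has at most one edge $(v,w)$ from $v$ to $w$ for each ordered pair of vertices. For an edge $e=(v,w)$, $s(e)=v$ is its source and $t(e)=w$ its target. A simple path in a digraph is a sequence of edges $e_1,\dots,e_k$ with $s(e_{i+1})=t(e_i)$ for all $i<k$, such that $s(e_i)=s(e_j)$ or $t(e_i)=t(e_j)$ implies $i=j$, and which is not a cycle, i.e. $s(e_1)\neq t(e_k)$. A multipath of a digraph $G$ is a spanning subgraph each of whose connected components is either a single vertex or a simple path. The multipath complex $X(G)$ is the (abstract) simplicial complex whose simplices are the nonempty edge sets of multipaths of $G$ (the empty simplex corresponds to the multipath with no edges). The bidirectional polygonal digraph $\mathtt{BP}_n$ has $n+1$ vertices $0,1,\dots,n$ and the $2n+2$ edges $(i,i+1)$ and $(i+1,i)$, with $i$ taken modulo $n+1$. Shellability is meant in the general (not necessarily pure) sense: a finite simplicial complex is shellable if its maximal faces can be ordered $F_1,\dots,F_k$ so that for every $2\le x\le k$ the subcomplex $\langle F_x\rangle\cap\bigcup_{i<x}\langle F_i\rangle$ is pure of dimension $\dim F_x-1$, where $\langle F\rangle$ denotes the complex of all faces of $F$. -}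

module Defs where

open import Data.Fin.Base using (Fin; zero; suc; toℕ; fromℕ; fromℕ<; inject₁; splitAt)
import Data.Fin.Base as Fin
open import Data.Fin.Properties
  using (any?; toℕ-injective; toℕ-fromℕ<; toℕ-inject₁; toℕ-fromℕ; toℕ<n; splitAt⁻¹-↑ˡ; splitAt⁻¹-↑ʳ)
  renaming (_≟_ to _≟ᶠ_)
open import Data.Fin.Subset using (Subset; _∈_; _⊆_; ∣_∣)
open import Data.Fin.Subset.Properties using (_∈?_)
open import Data.Integer.Base using (ℤ; +_; 1ℤ; _-_)
open import Data.Nat.Base
  using (ℕ; zero; suc; _+_; _∸_; _≤_; _<_; z≤n; s≤s)
open import Data.Nat.DivMod using (_mod_; _%_; n%n≡0; m<n⇒m%n≡m)
open import Data.Nat.Properties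
open import Data.Product.Base using (Σ; ∃-syntax; _×_; _,_; proj₁; proj₂)
open import Data.Sum.Base using (_⊎_; inj₁; inj₂; [_,_]′)
open import Function.Base using (id; _∘_)
open import Function.Bundles using (_⇔_; mk⇔; Equivalence)
open import Level using (0ℓ)
open import Relation.Binary.Construct.Closure.Equivalence as Eq using (EqClosure)
open import Relation.Binary.Construct.Closure.ReflexiveTransitive using (ε; _◅_; _◅◅_)
open import Relation.Binary.Construct.Closure.Symmetric using (fwd; bwd)
open import Relation.Binary.PropositionalEquality
  using (_≡_; _≢_; refl; sym; trans; cong; subst)
open import Relation.Nullary using (¬_; yes; no; contradiction)
open import Relation.Nullary.Decidable using (_×-dec_; _⊎-dec_)
open import Relation.Unary using (Pred; Decidable)

------------------------------------------------------------------------
-- Simplicial complexes and shellability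

-- The empty simplex counts as a face, of dimension -1; the complex without
-- any face at all is allowed.
record SimplicialComplex (N : ℕ) : Set₁ where
  field
    Face : Pred (Subset N) 0ℓ
    down : ∀ {S T} → T ⊆ S → Face S → Face T

open SimplicialComplex public

module _ {N : ℕ} where

  dim : Subset N → ℤ
  dim S = + ∣ S ∣ - 1ℤ

  IsMaximalFace : SimplicialComplex N → Pred (Subset N) 0ℓ
  IsMaximalFace K S = Face K S × (∀ T → Face K T → S ⊆ T → S ≡ T)

  PureOfDim : SimplicialComplex N → ℤ → Set
  PureOfDim K d = ∀ S → IsMaximalFace K S → dim S ≡ d

  ⟨_⟩ : Subset N → SimplicialComplex N
  ⟨ F ⟩ .Face S = S ⊆ F
  ⟨ F ⟩ .down T⊆S S⊆F = S⊆F ∘ T⊆S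

  infixr 7 _∩ᶜ_
  _∩ᶜ_ : SimplicialComplex N → SimplicialComplex N → SimplicialComplex N
  (K ∩ᶜ L) .Face S = Face K S × Face L S
  (K ∩ᶜ L) .down T⊆S (k , l) = down K T⊆S k , down L T⊆S l

  ⋃[_] : {I : Set} → (I → SimplicialComplex N) → SimplicialComplex N
  ⋃[ K ] .Face S = ∃[ i ] Face (K i) S
  ⋃[ K ] .down T⊆S (i , f) = i , down (K i) T⊆S f

  -- Positions are numbered from 0, so the first facet is exempt in shells.
  record IsShelling (K : SimplicialComplex N) {k : ℕ} (F : Fin k → Subset N) : Set where
    field
      injective  : ∀ {x y} → F x ≡ F y → x ≡ y
      enumerates : ∀ S → IsMaximalFace K S ⇔ (∃[ x ] F x ≡ S)
      shells     : ∀ x → 1 ≤ toℕ x →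
        PureOfDim (⟨ F x ⟩ ∩ᶜ ⋃[ (λ ((i , _) : ∃[ i ] i Fin.< x) → ⟨ F i ⟩) ]) (dim (F x) - 1ℤ)

  Shellable : SimplicialComplex N → Set
  Shellable K = ∃[ k ] Σ (Fin k → Subset N) (IsShelling K)

------------------------------------------------------------------------
-- Digraphs and multipaths

record Digraph : Set where
  field
    #V #E  : ℕ
    source : Fin #E → Fin #V
    target : Fin #E → Fin #V
    simple : ∀ {e f} → source e ≡ source f → target e ≡ target f → e ≡ f

module _ (G : Digraph) where
  open Digraph G

  -- The path has length + 1 edges, so it is nonempty.
  record SimplePath : Set where
    field
      length      : ℕ
      edge        : Fin (suc length) → Fin #E
      consecutive : ∀ (i : Fin length) → source (edge (suc i)) ≡ target (edge (inject₁ i))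
      nonrepeat   : ∀ i j →
        source (edge i) ≡ source (edge j) ⊎ target (edge i) ≡ target (edge j) → i ≡ j
      noncycle    : source (edge zero) ≢ target (edge (fromℕ length))

  _∈ᵖ_ : Fin #E → SimplePath → Set
  e ∈ᵖ p = ∃[ i ] SimplePath.edge p i ≡ e

  -- Below, a set S of edges stands for the spanning subgraph with edge set S.

  Adjacent : Subset #E → Fin #V → Fin #V → Set
  Adjacent S u w = ∃[ e ] e ∈ S × source e ≡ u × target e ≡ w

  Connected : Subset #E → Fin #V → Fin #V → Set
  Connected S = EqClosure (Adjacent S)

  -- The edges of the connected component of v; as source and target of an edge
  -- of S are connected, testing the source suffices.
  ComponentEdge : Subset #E → Fin #V → Fin #E → Set
  ComponentEdge S v e = e ∈ S × Connected S v (source e)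

  -- A component is determined by v and its edges: if it has none it is the
  -- single vertex v, and otherwise its vertices are the endpoints of its edges.
  IsMultipath : Subset #E → Set
  IsMultipath S = ∀ v →
      (∀ e → ¬ ComponentEdge S v e)
    ⊎ Σ SimplePath (λ p → ∀ e → ComponentEdge S v e ⇔ e ∈ᵖ p)

------------------------------------------------------------------------
-- Removing edges from a multipath leaves a multipath

-- Maximal runs of a decidable predicate around a given position

runˡ : {Q : ℕ → Set} → Decidable Q → ∀ i → Q i →
       ∃[ a ] a ≤ i × (∀ k → a ≤ k → k ≤ i → Q k) × (∀ k → suc k ≡ a → ¬ Q k)
runˡ Q? zero q = 0 , z≤n , (λ { zero _ _ → q }) , (λ _ ())
runˡ {Q} Q? (suc i) q with Q? i
... | no ¬q = suc i , ≤-refl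
            , (λ k a≤k k≤i → subst Q (≤-antisym a≤k k≤i) q)
            , (λ { k refl → ¬q })
... | yes q′ with a , a≤i , all , max ← runˡ Q? i q′ =
  a , m≤n⇒m≤1+n a≤i , all′ , max
  where
  all′ : ∀ k → a ≤ k → k ≤ suc i → Q k
  all′ k a≤k k≤1+i with m≤n⇒m<n∨m≡n k≤1+i
  ... | inj₁ (s≤s k≤i) = all k a≤k k≤i
  ... | inj₂ refl      = q

runʳ : {Q : ℕ → Set} → Decidable Q → ∀ d i → Q i →
       ∃[ b ] i ≤ b × b ≤ i + d × (∀ k → i ≤ k → k ≤ b → Q k) × (b < i + d → ¬ Q (suc b))
runʳ {Q} Q? zero i q = i , ≤-refl , m≤m+n i 0
                     , (λ k a≤k k≤i → subst Q (≤-antisym a≤k k≤i) q)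
                     , (λ i<i+0 _ → <-irrefl (sym (+-identityʳ i)) i<i+0)
runʳ {Q} Q? (suc d) i q with Q? (suc i)
... | no ¬q = i , ≤-refl , m≤m+n i _
            , (λ k a≤k k≤i → subst Q (≤-antisym a≤k k≤i) q)
            , (λ _ → ¬q)
... | yes q′ with b , i<b , b≤ , all , max ← runʳ Q? d (suc i) q′ =
  b , <⇒≤ i<b , subst (b ≤_) (sym (+-suc i d)) b≤ , all′
    , (λ b< → max (subst (b <_) (+-suc i d) b<))
  where
  all′ : ∀ k → i ≤ k → k ≤ b → Q k
  all′ k i≤k k≤b with m≤n⇒m<n∨m≡n i≤k
  ... | inj₁ i<k  = all k i<k k≤b
  ... | inj₂ refl = q

clamp : ∀ l → ℕ → Fin (suc l)
clamp zero    _       = zero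
clamp (suc l) zero    = zero
clamp (suc l) (suc m) = suc (clamp l m)

toℕ-clamp : ∀ l m → m ≤ l → toℕ (clamp l m) ≡ m
toℕ-clamp zero    zero    _         = refl
toℕ-clamp (suc l) zero    _         = refl
toℕ-clamp (suc l) (suc m) (s≤s m≤l) = cong suc (toℕ-clamp l m m≤l)

toℕ≤ : ∀ {l} (i : Fin (suc l)) → toℕ i ≤ l
toℕ≤ i with s≤s i≤l ← toℕ<n i = i≤l

clamp-toℕ : ∀ {l} (i : Fin (suc l)) → clamp l (toℕ i) ≡ i
clamp-toℕ {l} i = toℕ-injective (toℕ-clamp l (toℕ i) (toℕ≤ i))

module Path (G : Digraph) (p : SimplePath G) where
  open Digraph G
  open SimplePath p renaming (length to l)

  P : ℕ → Fin #E
  P m = edge (clamp l m)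

  P-toℕ : ∀ i → P (toℕ i) ≡ edge i
  P-toℕ i = cong edge (clamp-toℕ i)

  P-consecutive : ∀ k → k < l → source (P (suc k)) ≡ target (P k)
  P-consecutive k k<l =
    trans (cong source (edge≡ (suc i) (cong suc i≡k)))
      (trans (consecutive i) (cong target (sym (edge≡ (inject₁ i) (trans (toℕ-inject₁ i) i≡k)))))
    where
    i = fromℕ< k<l
    i≡k = toℕ-fromℕ< k<l
    edge≡ : ∀ (j : Fin (suc l)) {m} → toℕ j ≡ m → P m ≡ edge j
    edge≡ j refl = P-toℕ j

  P-nonrepeat : ∀ {j k} → j ≤ l → k ≤ l →
                source (P j) ≡ source (P k) ⊎ target (P j) ≡ target (P k) → j ≡ k
  P-nonrepeat {j} {k} j≤l k≤l eq =
    trans (sym (toℕ-clamp l j j≤l))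
      (trans (cong toℕ (nonrepeat _ _ eq)) (toℕ-clamp l k k≤l))

  P-noncycle : source (P 0) ≢ target (P l)
  P-noncycle eq = noncycle (trans (cong (source ∘ edge) (sym (clamp-toℕ zero)))
    (trans eq (cong (target ∘ edge)
      (toℕ-injective (trans (toℕ-clamp l l ≤-refl) (sym (toℕ-fromℕ l)))))))

  P-end : ∀ j → j ≤ l → source (P j) ≢ target (P l)
  P-end zero    _   = P-noncycle
  P-end (suc j) j<l eq = <⇒≢ j<l
    (P-nonrepeat (<⇒≤ j<l) ≤-refl (inj₂ (trans (sym (P-consecutive j j<l)) eq)))

  -- A vertex is left by an edge of the path only right after it is entered.
  P-meet : ∀ j k → j ≤ l → k ≤ l → source (P j) ≡ target (P k) → j ≡ suc k
  P-meet j k j≤l k≤l eq with m≤n⇒m<n∨m≡n k≤l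
  ... | inj₁ k<l = P-nonrepeat j≤l k<l (inj₁ (trans eq (sym (P-consecutive k k<l))))
  ... | inj₂ k≡l = contradiction (trans eq (cong (target ∘ P) k≡l)) (P-end j j≤l)

  segment : ∀ a b → a ≤ b → b ≤ l → SimplePath G
  segment a b a≤b b≤l = record
    { length      = b ∸ a
    ; edge        = λ i → P (a + toℕ i)
    ; consecutive = λ i → trans (cong (source ∘ P) (+-suc a (toℕ i)))
        (trans (P-consecutive (a + toℕ i) (<-≤-trans (lt i) b≤l))
          (cong (λ m → target (P (a + m))) (sym (toℕ-inject₁ i))))
    ; nonrepeat   = λ i j eq → toℕ-injective
        (+-cancelˡ-≡ a _ _ (P-nonrepeat (le i) (le j) eq))
    ; noncycle    = λ eq → <-irrefl
        (trans (sym (+-identityʳ a)) (P-meet _ _ (le zero) (le (fromℕ (b ∸ a))) eq))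
        (s≤s (m≤m+n a _))
    }
    where
    lt : ∀ (i : Fin (b ∸ a)) → a + toℕ i < b
    lt i = subst (a + toℕ i <_) (m+[n∸m]≡n a≤b) (+-monoʳ-< a (toℕ<n i))
    le : ∀ (i : Fin (suc (b ∸ a))) → a + toℕ i ≤ l
    le i = ≤-trans (subst (a + toℕ i ≤_) (m+[n∸m]≡n a≤b) (+-monoʳ-≤ a (toℕ≤ i))) b≤l

  module Restrict
    (S T : Subset #E) (T⊆S : T ⊆ S) (v : Fin #V)
    (component : ∀ e → ComponentEdge G S v e ⇔ _∈ᵖ_ G e p)
    (e₀ : Fin #E) (e₀∈T : e₀ ∈ T) (v∈e₀ : source e₀ ≡ v ⊎ target e₀ ≡ v)
    where

    T⇒S : ∀ {u w} → Connected G T u w → Connected G S u w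
    T⇒S = Eq.map (λ (e , e∈T , st) → e , T⊆S e∈T , st)

    Touches : Fin #V → Fin #E → Set
    Touches u e = source e ≡ u ⊎ target e ≡ u

    toSource : ∀ {u e} → e ∈ T → Touches u e → Connected G T u (source e)
    toSource e∈T (inj₁ refl) = ε
    toSource e∈T (inj₂ refl) = bwd (_ , e∈T , refl , refl) ◅ ε

    position : ∀ {e} → e ∈ T → Connected G T v (source e) → ∃[ k ] k ≤ l × P k ≡ e
    position e∈T v~e with i , eq ← Equivalence.to (component _) (T⊆S e∈T , T⇒S v~e) =
      toℕ i , toℕ≤ i , trans (P-toℕ i) eq

    component′ : Σ (SimplePath G) (λ q → ∀ e → ComponentEdge G T v e ⇔ _∈ᵖ_ G e q)
    component′
      with i , i≤l , Pi≡e₀ ← position e₀∈T (toSource e₀∈T v∈e₀)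
      with a , a≤i , allˡ , maxˡ ← runˡ (λ k → P k ∈? T) i (subst (_∈ T) (sym Pi≡e₀) e₀∈T)
         | b , i≤b , b≤ , allʳ , maxʳ ← runʳ (λ k → P k ∈? T) (l ∸ i) i (subst (_∈ T) (sym Pi≡e₀) e₀∈T)
      = segment a b a≤b b≤l , λ e → mk⇔ to (from e)
      where
      a≤b : a ≤ b
      a≤b = ≤-trans a≤i i≤b

      i+[l∸i] : i + (l ∸ i) ≡ l
      i+[l∸i] = m+[n∸m]≡n i≤l

      b≤l : b ≤ l
      b≤l = subst (b ≤_) i+[l∸i] b≤

      all : ∀ k → a ≤ k → k ≤ b → P k ∈ T
      all k a≤k k≤b with ≤-total k i
      ... | inj₁ k≤i = allˡ k a≤k k≤i
      ... | inj₂ i≤k = allʳ k i≤k k≤b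

      InRun : ℕ → Set
      InRun k = a ≤ k × k ≤ b

      up : ∀ {k} → InRun k → suc k ≤ l → P (suc k) ∈ T → InRun (suc k)
      up {k} (a≤k , k≤b) k<l q with m≤n⇒m<n∨m≡n k≤b
      ... | inj₁ k<b  = m≤n⇒m≤1+n a≤k , k<b
      ... | inj₂ refl = contradiction q (maxʳ (subst (b <_) (sym i+[l∸i]) k<l))

      dn : ∀ {k} → InRun (suc k) → P k ∈ T → InRun k
      dn {k} (a≤1+k , k<b) q with m≤n⇒m<n∨m≡n a≤1+k
      ... | inj₁ (s≤s a≤k) = a≤k , <⇒≤ k<b
      ... | inj₂ refl      = contradiction q (maxˡ k refl)

      OnRun : Fin #V → Set
      OnRun u = ∃[ k ] InRun k × Touches u (P k)

      extend : ∀ {u j} → OnRun u → j ≤ l → P j ∈ T → Touches u (P j) → InRun j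
      extend {j = j} (k , r@(_ , k≤b) , uk) j≤l q uj with uk | uj
      ... | inj₁ x | inj₁ y = subst InRun (P-nonrepeat (≤-trans k≤b b≤l) j≤l (inj₁ (trans x (sym y)))) r
      ... | inj₂ x | inj₂ y = subst InRun (P-nonrepeat (≤-trans k≤b b≤l) j≤l (inj₂ (trans x (sym y)))) r
      ... | inj₂ x | inj₁ y with refl ← P-meet j k j≤l (≤-trans k≤b b≤l) (trans y (sym x)) = up r j≤l q
      ... | inj₁ x | inj₂ y with refl ← P-meet k j (≤-trans k≤b b≤l) j≤l (trans x (sym y)) = dn r q

      inRun : ∀ {u e} → OnRun u → Connected G T v u → e ∈ T → Touches u e →
              ∃[ k ] InRun k × P k ≡ e
      inRun o v~u e∈T ue
        with k , k≤l , refl ← position e∈T (v~u ◅◅ toSource e∈T ue)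
        = k , extend o k≤l e∈T ue , refl

      walk : ∀ {u w} → Connected G T v u → OnRun u → Connected G T u w → OnRun w
      walk v~u o ε = o
      walk v~u o (s@(fwd (e , e∈T , x , y)) ◅ rest)
        with k , r , refl ← inRun o v~u e∈T (inj₁ x) =
        walk (v~u ◅◅ (s ◅ ε)) (k , r , inj₂ y) rest
      walk v~u o (s@(bwd (e , e∈T , x , y)) ◅ rest)
        with k , r , refl ← inRun o v~u e∈T (inj₂ y) =
        walk (v~u ◅◅ (s ◅ ε)) (k , r , inj₁ x) rest

      start : OnRun v
      start = i , (a≤i , i≤b) , subst (Touches v) (sym Pi≡e₀) v∈e₀

      to : ∀ {e} → ComponentEdge G T v e → _∈ᵖ_ G e (segment a b a≤b b≤l)
      to {e} (e∈T , v~e)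
        with k , (a≤k , k≤b) , refl ← inRun (walk ε start v~e) v~e e∈T (inj₁ refl)
        = fromℕ< k-a< , cong P (trans (cong (λ m → a + m) (toℕ-fromℕ< k-a<)) (m+[n∸m]≡n a≤k))
        where
        k-a< : k ∸ a < suc (b ∸ a)
        k-a< = s≤s (∸-monoˡ-≤ a k≤b)

      step : ∀ k → a ≤ k → suc k ≤ b → Adjacent G T (source (P k)) (source (P (suc k)))
      step k a≤k k<b = P k , all k a≤k (<⇒≤ k<b) , refl
                     , sym (P-consecutive k (<-≤-trans k<b b≤l))

      fromStart : ∀ d → a + d ≤ b → Connected G T (source (P a)) (source (P (a + d)))
      fromStart zero    _  rewrite +-identityʳ a = ε
      fromStart (suc d) le rewrite +-suc a d =
        fromStart d (<⇒≤ le) ◅◅ (fwd (step (a + d) (m≤m+n a d) le) ◅ ε)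

      v~run : ∀ k → InRun k → Connected G T v (source (P k))
      v~run k (a≤k , k≤b) =
        subst (λ e → Connected G T v (source e)) (sym Pi≡e₀) (toSource e₀∈T v∈e₀)
          ◅◅ Eq.symmetric _ (reach a≤i i≤b) ◅◅ reach a≤k k≤b
        where
        reach : ∀ {m} → a ≤ m → m ≤ b → Connected G T (source (P a)) (source (P m))
        reach {m} a≤m m≤b =
          subst (λ n → Connected G T (source (P a)) (source (P n))) (m+[n∸m]≡n a≤m)
            (fromStart (m ∸ a) (subst (_≤ b) (sym (m+[n∸m]≡n a≤m)) m≤b))

      from : ∀ e → _∈ᵖ_ G e (segment a b a≤b b≤l) → ComponentEdge G T v e
      from _ (j , refl) = all _ (proj₁ r) (proj₂ r) , v~run _ r
        where
        r : InRun (a + toℕ j)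
        r = m≤m+n a _ , subst (a + toℕ j ≤_) (m+[n∸m]≡n a≤b) (+-monoʳ-≤ a (toℕ≤ j))

module _ (G : Digraph) where
  open Digraph G

  IsMultipath-⊆ : ∀ {S T} → T ⊆ S → IsMultipath G S → IsMultipath G T
  IsMultipath-⊆ {S} {T} T⊆S mS v
    with any? (λ e → (e ∈? T) ×-dec ((source e ≟ᶠ v) ⊎-dec (target e ≟ᶠ v)))
  ... | no none = inj₁ λ e (e∈T , v~e) → isolated e∈T v~e
    where
    isolated : ∀ {e} → e ∈ T → ¬ Connected G T v (source e)
    isolated e∈T ε = none (_ , e∈T , inj₁ refl)
    isolated _ (fwd (f , f∈T , x , _) ◅ _) = none (f , f∈T , inj₁ x)
    isolated _ (bwd (f , f∈T , _ , y) ◅ _) = none (f , f∈T , inj₂ y)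
  ... | yes (e₀ , e₀∈T , v∈e₀) with mS v
  ...   | inj₁ none = contradiction (T⊆S e₀∈T , conn v∈e₀) (none e₀)
    where
    conn : source e₀ ≡ v ⊎ target e₀ ≡ v → Connected G S v (source e₀)
    conn (inj₁ refl) = ε
    conn (inj₂ refl) = bwd (e₀ , T⊆S e₀∈T , refl , refl) ◅ ε
  ...   | inj₂ (p , comp) =
    inj₂ (Path.Restrict.component′ G p S T T⊆S v comp e₀ e₀∈T v∈e₀)

  MultipathComplex : SimplicialComplex #E
  MultipathComplex .Face = IsMultipath G
  MultipathComplex .down = IsMultipath-⊆

------------------------------------------------------------------------
-- Bidirectional polygonal digraphs

next : ∀ {n} → Fin (suc n) → Fin (suc n)
next {n} i = suc (toℕ i) mod suc n

-- The first n + 1 edges are the (i , i + 1), the last n + 1 are the (i + 1 , i).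
BP-source BP-target : ∀ n → Fin (suc n + suc n) → Fin (suc n)
BP-source n e = [ id , next ]′ (splitAt (suc n) e)
BP-target n e = [ next , id ]′ (splitAt (suc n) e)

next-cases : ∀ {n} (i : Fin (suc n)) →
             toℕ (next i) ≡ suc (toℕ i) ⊎ (toℕ (next i) ≡ 0 × toℕ i ≡ n)
next-cases {n} i with m≤n⇒m<n∨m≡n (toℕ<n i)
... | inj₁ i+1<  = inj₁ (trans (toℕ-fromℕ< _) (m<n⇒m%n≡m i+1<))
... | inj₂ i+1≡  = inj₂ ( trans (toℕ-fromℕ< _) (trans (cong (_% suc n) i+1≡) (n%n≡0 (suc n)))
                        , suc-injective i+1≡)

-- This fails for n = 1, where (0 , 1) and (1 , 0) would each be listed twice.
next∘next : ∀ {n} → 2 ≤ n → (i j : Fin (suc n)) → i ≡ next j → next i ≢ j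
next∘next {n} 2≤n i j i≡ next≡j with next-cases i | next-cases j
... | inj₁ x       | inj₁ y       = 1+n≰n {toℕ i} (subst (_≤ toℕ i)
        (trans (sym (cong toℕ next≡j)) x)
        (≤-trans (n≤1+n _) (≤-reflexive (sym (trans (cong toℕ i≡) y)))))
... | inj₁ x       | inj₂ (y , w) =
        1+n≰n (subst (2 ≤_) (trans (sym w) (trans (cong toℕ (sym next≡j))
          (trans x (cong suc (trans (cong toℕ i≡) y))))) 2≤n)
... | inj₂ (x , z) | inj₁ y       =
        1+n≰n (subst (2 ≤_) (trans (sym z) (trans (cong toℕ i≡)
          (trans y (cong suc (trans (cong toℕ (sym next≡j)) x))))) 2≤n)
... | inj₂ (x , z) | inj₂ (y , w) =
        n≮0 (subst (2 ≤_) (trans (sym z) (trans (cong toℕ i≡) y)) 2≤n)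

BP-simple : ∀ {n} → 2 ≤ n → ∀ {e f} →
            BP-source n e ≡ BP-source n f → BP-target n e ≡ BP-target n f → e ≡ f
BP-simple {n} 2≤n {e} {f} s t with splitAt (suc n) e in p | splitAt (suc n) f in q
... | inj₁ i | inj₁ j with refl ← s = trans (sym (splitAt⁻¹-↑ˡ p)) (splitAt⁻¹-↑ˡ q)
... | inj₂ i | inj₂ j with refl ← t =
  trans (sym (splitAt⁻¹-↑ʳ {suc n} p)) (splitAt⁻¹-↑ʳ {suc n} q)
... | inj₁ i | inj₂ j = contradiction t (next∘next 2≤n i j s)
... | inj₂ i | inj₁ j = contradiction s (next∘next 2≤n i j t)

BP : ∀ n → 2 ≤ n → Digraph
BP n 2≤n = record
  { #V     = suc n
  ; #E     = suc n + suc n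
  ; source = BP-source n
  ; target = BP-target n
  ; simple = BP-simple 2≤n
  }

{-# OPTIONS --safe #-}

-- The only facets contained in one of the two directed (n + 1)-cycles C are
-- the sets C - c. An edge e outside C is the reverse of an edge of C, so it
-- excludes three edges of C: this reverse, the one with the source of e and
-- the one with the target of e. So a face that has |C| - 2 edges of C lies
-- inside C. If a facet C - c of a shelling is not the first one, then it
-- shares |C| - 2 edges with an earlier facet, which is thus again contained
-- in C. By descent the first facet is contained in C. This holds for both
-- cycles, but they are disjoint.

module Submission where

open import Defs
open import Data.Bool.Base using (true)
open import Data.Fin.Base using (Fin; zero; suc; toℕ; fromℕ<; opposite; splitAt; _↑ˡ_; _↑ʳ_)
import Data.Fin.Base as Fin
import Data.Fin.Induction as FinI
open import Data.Fin.Properties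
  using (any?; ¬Fin0; toℕ-injective; toℕ-fromℕ<; toℕ-inject₁; toℕ-fromℕ; toℕ<n; opposite-prop; opposite-involutive;
         splitAt-↑ˡ; splitAt-↑ʳ; splitAt⁻¹-↑ˡ; splitAt⁻¹-↑ʳ)
  renaming (_≟_ to _≟ᶠ_)
open import Data.Fin.Subset using (Subset; inside; outside; _∈_; _∉_; _⊆_; _⊃_; _-_; ∣_∣; ⊥)
open import Data.Fin.Subset.Induction using (⊃-wellFounded)
open import Data.Fin.Subset.Properties
open import Data.Integer.Base using (+_; 1ℤ)
import Data.Integer.Base as ℤ
open import Data.Nat.Base using (ℕ; zero; suc; _+_; _*_; _∸_; _≤_; _<_; z≤n; s≤s; NonZero)
open import Data.Nat.DivMod
open import Data.Nat.Properties
open import Data.Product.Base using (Σ; ∃-syntax; _×_; _,_; proj₁)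
open import Data.Sum.Base using (_⊎_; inj₁; inj₂; [_,_]′)
open import Data.Vec.Base using (_∷_; there; tabulate)
open import Data.Vec.Properties using (lookup∘tabulate; lookup⇒[]=; []=⇒lookup)
open import Function.Base using (id; _∘_)
open import Function.Bundles using (_⇔_; mk⇔; Equivalence)
open import Induction.WellFounded using (Acc; acc)
open import Relation.Binary.Construct.Closure.Equivalence as Eq using ()
open import Relation.Binary.Construct.Closure.ReflexiveTransitive using (ε; _◅_; _◅◅_)
open import Relation.Binary.Construct.Closure.Symmetric using (fwd; bwd)
open import Relation.Binary.PropositionalEquality
open import Relation.Nullary using (¬_; Dec; yes; no; does; contradiction)
open import Relation.Nullary.Decidable using (¬?; dec-true; decidable-stable)

-- Finite subsets

x∉p-x : ∀ {N} (p : Subset N) x → x ∉ p - x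
x∉p-x (inside  ∷ p) zero ()
x∉p-x (outside ∷ p) zero ()
x∉p-x (_ ∷ p) (suc x) (there x∈) = x∉p-x p x x∈

∣p∣≤1+∣p-x∣ : ∀ {N} (p : Subset N) x → ∣ p ∣ ≤ suc ∣ p - x ∣
∣p∣≤1+∣p-x∣ (inside  ∷ p) zero    = s≤s (≤-reflexive (cong ∣_∣ (sym (p─⊥≡p p))))
∣p∣≤1+∣p-x∣ (outside ∷ p) zero    = m≤n⇒m≤1+n (≤-reflexive (cong ∣_∣ (sym (p─⊥≡p p))))
∣p∣≤1+∣p-x∣ (inside  ∷ p) (suc x) = s≤s (∣p∣≤1+∣p-x∣ p x)
∣p∣≤1+∣p-x∣ (outside ∷ p) (suc x) = ∣p∣≤1+∣p-x∣ p x

p⊆q∧x∉p⇒p⊆q-x : ∀ {N} {p q : Subset N} {x} → p ⊆ q → x ∉ p → p ⊆ q - x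
p⊆q∧x∉p⇒p⊆q-x p⊆q x∉p y∈p = x∈p∧x≢y⇒x∈p-y (p⊆q y∈p) λ { refl → x∉p y∈p }

p-x⊆q∧x∈q⇒p⊆q : ∀ {N} {p q : Subset N} {x} → p - x ⊆ q → x ∈ q → p ⊆ q
p-x⊆q∧x∈q⇒p⊆q {x = x} p-x⊆q x∈q {y} y∈p with y ≟ᶠ x
... | yes refl = x∈q
... | no y≢x   = p-x⊆q (x∈p∧x≢y⇒x∈p-y y∈p y≢x)

image : ∀ {M N} → (Fin M → Fin N) → Subset N
image f = tabulate λ y → does (any? λ x → f x ≟ᶠ y)

∈-image⁺ : ∀ {M N} (f : Fin M → Fin N) x → f x ∈ image f
∈-image⁺ f x = lookup⇒[]= (f x) _
  (trans (lookup∘tabulate _ (f x)) (dec-true (any? λ x′ → f x′ ≟ᶠ f x) (x , refl)))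

∈-image⁻ : ∀ {M N} (f : Fin M → Fin N) {y} → y ∈ image f → ∃[ x ] f x ≡ y
∈-image⁻ f {y} y∈ = witness (any? λ x → f x ≟ᶠ y)
  (trans (sym (lookup∘tabulate _ y)) ([]=⇒lookup y∈))
  where
  witness : ∀ {A : Set} (A? : Dec A) → does A? ≡ true → A
  witness (yes a) _ = a

-- Rotations of Fin (suc n)

%-distribʳ-+ : ∀ i j m .{{_ : NonZero m}} → (i + j % m) % m ≡ (i + j) % m
%-distribʳ-+ i j m = begin
  (i + j % m) % m          ≡⟨ %-distribˡ-+ i (j % m) m ⟩
  (i % m + j % m % m) % m  ≡⟨ cong (λ r → (i % m + r) % m) (m%n%n≡m%n j m) ⟩
  (i % m + j % m) % m      ≡⟨ %-distribˡ-+ i j m ⟨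
  (i + j) % m              ∎
  where open ≡-Reasoning

[i*n+[i+j]]%[1+n]≡j%[1+n] : ∀ i j n → (i * n + (i + j)) % suc n ≡ j % suc n
[i*n+[i+j]]%[1+n]≡j%[1+n] i j n = begin
  (i * n + (i + j)) % suc n  ≡⟨ cong (_% suc n) (+-assoc (i * n) i j) ⟨
  (i * n + i + j) % suc n    ≡⟨ cong (λ s → (s + j) % suc n) (trans (+-comm (i * n) i) (sym (*-suc i n))) ⟩
  (i * suc n + j) % suc n    ≡⟨ cong (_% suc n) (+-comm (i * suc n) j) ⟩
  (j + i * suc n) % suc n    ≡⟨ [m+kn]%n≡m%n j i (suc n) ⟩
  j % suc n                  ∎
  where open ≡-Reasoning

%-cancelˡ-+ : ∀ i j k n → (i + j) % suc n ≡ (i + k) % suc n → j % suc n ≡ k % suc n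
%-cancelˡ-+ i j k n eq = begin
  j % suc n                            ≡⟨ [i*n+[i+j]]%[1+n]≡j%[1+n] i j n ⟨
  (i * n + (i + j)) % suc n            ≡⟨ %-distribʳ-+ (i * n) (i + j) (suc n) ⟨
  (i * n + (i + j) % suc n) % suc n    ≡⟨ cong (λ r → (i * n + r) % suc n) eq ⟩
  (i * n + (i + k) % suc n) % suc n    ≡⟨ %-distribʳ-+ (i * n) (i + k) (suc n) ⟩
  (i * n + (i + k)) % suc n            ≡⟨ [i*n+[i+j]]%[1+n]≡j%[1+n] i k n ⟩
  k % suc n                            ∎
  where open ≡-Reasoning

toℕ%≡toℕ : ∀ {n} (i : Fin (suc n)) → toℕ i % suc n ≡ toℕ i
toℕ%≡toℕ i = m<n⇒m%n≡m (toℕ<n i)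

toℕ-next : ∀ {n} (i : Fin (suc n)) → toℕ (next i) ≡ suc (toℕ i) % suc n
toℕ-next i = toℕ-fromℕ< _

next-injective : ∀ {n} {i j : Fin (suc n)} → next i ≡ next j → i ≡ j
next-injective {n} {i} {j} eq = toℕ-injective (begin
  toℕ i          ≡⟨ toℕ%≡toℕ i ⟨
  toℕ i % suc n  ≡⟨ %-cancelˡ-+ 1 (toℕ i) (toℕ j) n (trans (sym (toℕ-next i)) (trans (cong toℕ eq) (toℕ-next j))) ⟩
  toℕ j % suc n  ≡⟨ toℕ%≡toℕ j ⟩
  toℕ j          ∎)
  where open ≡-Reasoning

-- `opposite` reverses the cyclic order, so it conjugates `next` to its inverse. Where `next` wraps
-- around, `i` is the last index and both sides are `zero`.
opposite-next : ∀ {n} (i : Fin (suc n)) → next (opposite (next i)) ≡ opposite i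
opposite-next {n} i = toℕ-injective (begin
  toℕ (next (opposite (next i)))         ≡⟨ toℕ-next (opposite (next i)) ⟩
  suc (toℕ (opposite (next i))) % suc n  ≡⟨ cong (λ k → suc k % suc n) (opposite-prop (next i)) ⟩
  suc (n ∸ toℕ (next i)) % suc n         ≡⟨ cases (next-cases i) ⟩
  n ∸ toℕ i                              ≡⟨ opposite-prop i ⟨
  toℕ (opposite i)                       ∎)
  where
  open ≡-Reasoning
  cases : toℕ (next i) ≡ suc (toℕ i) ⊎ (toℕ (next i) ≡ 0 × toℕ i ≡ n) →
          suc (n ∸ toℕ (next i)) % suc n ≡ n ∸ toℕ i
  cases (inj₁ eq) = begin
    suc (n ∸ toℕ (next i)) % suc n  ≡⟨ cong (_% suc n) (+-∸-assoc 1 (toℕ≤ (next i))) ⟨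
    (suc n ∸ toℕ (next i)) % suc n  ≡⟨ cong (λ k → (suc n ∸ k) % suc n) eq ⟩
    (n ∸ toℕ i) % suc n             ≡⟨ m≤n⇒m%n≡m (m∸n≤m n (toℕ i)) ⟩
    n ∸ toℕ i                       ∎
  cases (inj₂ (eq , i≡n)) = begin
    suc (n ∸ toℕ (next i)) % suc n  ≡⟨ cong (λ k → suc (n ∸ k) % suc n) eq ⟩
    suc n % suc n                   ≡⟨ n%n≡0 (suc n) ⟩
    0                               ≡⟨ n∸n≡0 n ⟨
    n ∸ n                           ≡⟨ cong (n ∸_) i≡n ⟨
    n ∸ toℕ i                       ∎

rotate : ∀ {n} → ℕ → Fin (suc n) → Fin (suc n)
rotate zero    i = i
rotate (suc k) i = next (rotate k i)

toℕ-rotate : ∀ {n} k (i : Fin (suc n)) → toℕ (rotate k i) ≡ (toℕ i + k) % suc n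
toℕ-rotate {n} zero    i = sym (trans (cong (_% suc n) (+-identityʳ (toℕ i))) (toℕ%≡toℕ i))
toℕ-rotate {n} (suc k) i = begin
  toℕ (next (rotate k i))            ≡⟨ toℕ-next (rotate k i) ⟩
  suc (toℕ (rotate k i)) % suc n     ≡⟨ cong (λ r → suc r % suc n) (toℕ-rotate k i) ⟩
  (1 + (toℕ i + k) % suc n) % suc n  ≡⟨ %-distribʳ-+ 1 (toℕ i + k) (suc n) ⟩
  suc (toℕ i + k) % suc n            ≡⟨ cong (_% suc n) (+-suc (toℕ i) k) ⟨
  (toℕ i + suc k) % suc n            ∎
  where open ≡-Reasoning

rotate-injective : ∀ {n} (i : Fin (suc n)) {j k} → j ≤ n → k ≤ n → rotate j i ≡ rotate k i → j ≡ k
rotate-injective {n} i {j} {k} j≤n k≤n eq = begin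
  j          ≡⟨ m≤n⇒m%n≡m j≤n ⟨
  j % suc n  ≡⟨ %-cancelˡ-+ (toℕ i) j k n (trans (sym (toℕ-rotate j i)) (trans (cong toℕ eq) (toℕ-rotate k i))) ⟩
  k % suc n  ≡⟨ m≤n⇒m%n≡m k≤n ⟩
  k          ∎
  where open ≡-Reasoning

rotate-surjective : ∀ {n} (i j : Fin (suc n)) → ∃[ k ] k ≤ n × rotate k i ≡ j
rotate-surjective {n} i j = k % suc n , m<1+n⇒m≤n (m%n<n k (suc n)) , toℕ-injective (begin
  toℕ (rotate (k % suc n) i)                     ≡⟨ toℕ-rotate (k % suc n) i ⟩
  (toℕ i + k % suc n) % suc n                    ≡⟨ %-distribʳ-+ (toℕ i) k (suc n) ⟩
  (toℕ i + (toℕ i * n + toℕ j)) % suc n          ≡⟨ cong (_% suc n) (x∙yz≈y∙xz (toℕ i) (toℕ i * n) (toℕ j)) ⟩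
  (toℕ i * n + (toℕ i + toℕ j)) % suc n          ≡⟨ [i*n+[i+j]]%[1+n]≡j%[1+n] (toℕ i) (toℕ j) n ⟩
  toℕ j % suc n                                  ≡⟨ toℕ%≡toℕ j ⟩
  toℕ j                                          ∎)
  where
  open ≡-Reasoning
  open import Algebra.Properties.CommutativeSemigroup +-commutativeSemigroup using (x∙yz≈y∙xz)
  -- With `toℕ i * n` as the negative of `toℕ i`, this is `j` minus `i` modulo `suc n`.
  k = toℕ i * n + toℕ j

rotate-[1+n] : ∀ {n} (i : Fin (suc n)) → rotate (suc n) i ≡ i
rotate-[1+n] {n} i = toℕ-injective
  (trans (toℕ-rotate (suc n) i) (trans ([m+n]%n≡m%n (toℕ i) (suc n)) (toℕ%≡toℕ i)))

rotate-next : ∀ {n} k (i : Fin (suc n)) → rotate k (next i) ≡ next (rotate k i)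
rotate-next zero    i = refl
rotate-next (suc k) i = cong next (rotate-next k i)

-- Simplicial complexes

-- A maximal face need not be computable, as faces need not be decidable.
pure⇒¬¬face : ∀ {N} (K : SimplicialComplex N) {d} → PureOfDim K d →
              ∀ {S} → Face K S → ¬ (∀ T → Face K T → dim T ≢ d)
pure⇒¬¬face K {d} pure {S} faceS none = go S (⊃-wellFounded S) faceS
  where
  go : ∀ S → Acc _⊃_ S → ¬ Face K S
  -- By induction no proper superset of `S` is a face, so `S` is maximal, and purity gives it the
  -- dimension that `none` excludes.
  go S (acc rec) faceS = none S faceS (pure S (faceS , maximal))
    where
    maximal : ∀ T → Face K T → S ⊆ T → S ≡ T
    maximal T faceT S⊆T with S ⊂? T
    ... | yes S⊂T = contradiction faceT (go T (rec S⊂T))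
    ... | no S⊄T  = ⊆-antisym S⊆T λ {x} x∈T → decidable-stable (x ∈? S)
      λ x∉S → S⊄T (S⊆T , x , x∈T , x∉S)

dim≡dim-1⇒ : ∀ {N} (S F : Subset N) → dim S ≡ dim F ℤ.- 1ℤ → ∣ F ∣ ≡ suc ∣ S ∣
dim≡dim-1⇒ S F = drop ∣ S ∣ ∣ F ∣
  where
  drop : ∀ a b → + a ℤ.- 1ℤ ≡ + b ℤ.- 1ℤ ℤ.- 1ℤ → b ≡ suc a
  drop zero    (suc zero)    _    = refl
  drop (suc a) (suc (suc .a)) refl = refl

-- Multipaths

module Multipath (G : Digraph) {S} (multipath : IsMultipath G S) where
  open Digraph G
  open SimplePath using (edge; nonrepeat)

  component : ∀ {e} → e ∈ S → Σ (SimplePath G) λ p → ∀ f → ComponentEdge G S (source e) f ⇔ _∈ᵖ_ G f p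
  component {e} e∈S with multipath (source e)
  ... | inj₁ none = contradiction (e∈S , ε) (none e)
  ... | inj₂ p    = p

  -- Turns claims about two edges of one component into claims about positions on a single simple
  -- path.
  path-through : ∀ {e f} → e ∈ S → f ∈ S → Connected G S (source e) (source f) →
                 Σ (SimplePath G) λ p → _∈ᵖ_ G e p × _∈ᵖ_ G f p
  path-through e∈S f∈S e~f with p , comp ← component e∈S =
    p , Equivalence.to (comp _) (e∈S , ε) , Equivalence.to (comp _) (f∈S , e~f)

  source-injective : ∀ {e f} → e ∈ S → f ∈ S → source e ≡ source f → e ≡ f
  source-injective {e} e∈S f∈S eq
    with p , (i , refl) , (j , refl) ← path-through e∈S f∈S (subst (Connected G S (source e)) eq ε)
    = cong (edge p) (nonrepeat p i j (inj₁ eq))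

  target-injective : ∀ {e f} → e ∈ S → f ∈ S → target e ≡ target f → e ≡ f
  target-injective {e} {f} e∈S f∈S eq
    with p , (i , refl) , (j , refl) ← path-through e∈S f∈S
           (fwd (e , e∈S , refl , eq) ◅ bwd (f , f∈S , refl , refl) ◅ ε)
    = cong (edge p) (nonrepeat p i j (inj₂ eq))

  -- The two edges would lie on one path, each at the position right after the other.
  no-2-cycle : ∀ {e f} → e ∈ S → f ∈ S → source e ≡ target f → target e ≢ source f
  no-2-cycle {e} {f} e∈S f∈S s≡t t≡s
    with p , (i , refl) , (j , refl) ← path-through e∈S f∈S (fwd (e , e∈S , refl , t≡s) ◅ ε)
    = m≢1+n+m (toℕ i) (trans (follows i j s≡t) (cong suc (follows j i (sym t≡s))))
    where
    open Path G p
    follows : ∀ i j → source (edge p i) ≡ target (edge p j) → toℕ i ≡ suc (toℕ j)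
    follows i j eq = P-meet (toℕ i) (toℕ j) (toℕ≤ i) (toℕ≤ j)
      (trans (cong source (P-toℕ i)) (trans eq (cong target (sym (P-toℕ j)))))

  -- A successor of the last edge on the path through `e` would be in the same component, hence on
  -- this path, but no edge of a simple path starts where the path ends.
  no-successor : ∀ {e} → e ∈ S → ¬ (∀ {f} → f ∈ S → ∃[ g ] g ∈ S × source g ≡ target f)
  no-successor {e} e∈S successor
    with p , comp ← component e∈S
    with z∈S , e~z ← Equivalence.from (comp _) (clamp _ (SimplePath.length p) , refl)
    with g , g∈S , eq ← successor z∈S
    with j , refl ← Equivalence.to (comp g) (g∈S , e~z ◅◅ (fwd (_ , z∈S , refl , sym eq) ◅ ε))
    = P-end (toℕ j) (toℕ≤ j) (trans (cong source (P-toℕ j)) eq)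
    where open Path G p

-- Hamiltonian cycles

-- `H` lists the edges in the order of travel. The index type gives the cycle at least two edges, so
-- it contains no loop and removing an edge leaves a nonempty path.
module HamiltonianCycle
  (G : Digraph) {n : ℕ} (H : Fin (suc (suc n)) → Fin (Digraph.#E G))
  (target-H : ∀ i → Digraph.target G (H i) ≡ Digraph.source G (H (next i)))
  (source-H-injective  : ∀ {i j} → Digraph.source G (H i) ≡ Digraph.source G (H j) → i ≡ j)
  (source-H-surjective : ∀ v → ∃[ i ] Digraph.source G (H i) ≡ v)
  where

  open Digraph G

  C : Subset #E
  C = image H

  K : SimplicialComplex #E
  K = MultipathComplex G

  target-H-surjective : ∀ v → ∃[ i ] target (H i) ≡ v
  target-H-surjective v with i , refl ← source-H-surjective v =
    -- The cycle has `suc (suc n)` edges, so this rotation is one step back.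
    rotate (suc n) i , trans (target-H _) (cong (source ∘ H) (rotate-[1+n] i))

  no-loop : ∀ i → source (H i) ≢ target (H i)
  no-loop i eq with () ← rotate-injective i {0} {1} z≤n (s≤s z≤n) (source-H-injective (trans eq (target-H i)))

  C-not-face : ¬ Face K C
  C-not-face faceC = Multipath.no-successor G faceC (∈-image⁺ H zero) successor
    where
    successor : ∀ {f} → f ∈ C → ∃[ g ] g ∈ C × source g ≡ target f
    successor f∈C with i , refl ← ∈-image⁻ H f∈C = H (next i) , ∈-image⁺ H (next i) , sym (target-H i)

  -- The Hamiltonian path left by removing one edge

  module _ (i : Fin (suc (suc n))) where

    -- The path starts right after the removed edge, and it ends at the source
    -- vertex v (suc n) of this edge.
    private
      v : ℕ → Fin (suc (suc n))
      v k = rotate k (next i)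

      v-last : v (suc n) ≡ i
      v-last = trans (rotate-next (suc n) i) (rotate-[1+n] i)

      D : Subset #E
      D = C - H i

    Hv∈D : ∀ {k} → k ≤ n → H (v k) ∈ D
    Hv∈D k≤n = x∈p∧x≢y⇒x∈p-y (∈-image⁺ H _) λ eq → <-irrefl
      (rotate-injective (next i) (m≤n⇒m≤1+n k≤n) ≤-refl
        (trans (source-H-injective (cong source eq)) (sym v-last)))
      (s≤s k≤n)

    path : SimplePath G
    path = record
      { length      = n
      ; edge        = λ k → H (v (toℕ k))
      ; consecutive = λ k → trans (sym (target-H _)) (cong (target ∘ H ∘ v) (sym (toℕ-inject₁ k)))
      ; nonrepeat   = λ j k → λ
        { (inj₁ eq) → v-injective j k (source-H-injective eq)
        ; (inj₂ eq) → v-injective j k (next-injective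
            (source-H-injective (trans (sym (target-H _)) (trans eq (target-H _)))))
        }
      ; noncycle    = λ eq → 0≢1+n (rotate-injective (next i) z≤n (s≤s (≤-reflexive (toℕ-fromℕ n)))
          (source-H-injective (trans eq (target-H _))))
      }
      where
      v-injective : ∀ (j k : Fin (suc n)) → v (toℕ j) ≡ v (toℕ k) → j ≡ k
      v-injective j k eq = toℕ-injective
        (rotate-injective (next i) (<⇒≤ (toℕ<n j)) (<⇒≤ (toℕ<n k)) eq)

    ∈D⇔∈path : ∀ e → e ∈ D ⇔ _∈ᵖ_ G e path
    ∈D⇔∈path e = mk⇔ to from
      where
      to : e ∈ D → _∈ᵖ_ G e path
      to e∈D with j , refl ← ∈-image⁻ H (p─q⊆p C _ e∈D)
        with k , k≤1+n , refl ← rotate-surjective (next i) j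
        with m≤n⇒m<n∨m≡n k≤1+n
      ... | inj₁ k<1+n = fromℕ< k<1+n , cong (H ∘ v) (toℕ-fromℕ< k<1+n)
      ... | inj₂ refl  = contradiction (subst (λ j → H j ∈ D) v-last e∈D) (x∉p-x C (H i))
      from : _∈ᵖ_ G e path → e ∈ D
      from (k , refl) = Hv∈D (toℕ≤ k)

    -- The bound is `suc n`, although edges of the path have positions up to `n`: the last vertex is
    -- only the target of an edge.
    connected-from-start : ∀ k → k ≤ suc n → Connected G D (source (H (v 0))) (source (H (v k)))
    connected-from-start zero    _     = ε
    connected-from-start (suc k) k<1+n = connected-from-start k (<⇒≤ k<1+n) ◅◅
      (fwd (H (v k) , Hv∈D (m<1+n⇒m≤n k<1+n) , refl , target-H (v k)) ◅ ε)

    start-connected-to : ∀ u → Connected G D (source (H (v 0))) u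
    start-connected-to u with j , refl ← source-H-surjective u
      with k , k≤1+n , refl ← rotate-surjective (next i) j = connected-from-start k k≤1+n

    -- The path reaches every vertex, so there is one component and the same path serves for each
    -- `u`.
    C-minus-edge-face : Face K D
    C-minus-edge-face u = inj₂ (path , λ e → mk⇔
      (λ (e∈D , _) → Equivalence.to (∈D⇔∈path e) e∈D)
      (λ e∈p → Equivalence.from (∈D⇔∈path e) e∈p
             , Eq.symmetric _ (start-connected-to u) ◅◅ start-connected-to (source e)))

  -- `C` is not a face, so `F` misses some `H i` and lies in the face `C - H i`. Maximality gives
  -- equality.
  facet⊆C⇒≡ : ∀ {F} → IsMaximalFace K F → F ⊆ C → ∃[ i ] F ≡ C - H i
  facet⊆C⇒≡ {F} (face , maximal) F⊆C with any? (λ i → ¬? (H i ∈? F))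
  ... | yes (i , Hi∉F) = i , maximal _ (C-minus-edge-face i) (p⊆q∧x∉p⇒p⊆q-x F⊆C Hi∉F)
  ... | no none        = contradiction (down K C⊆F face) C-not-face
    where
    C⊆F : C ⊆ F
    C⊆F e∈C with i , refl ← ∈-image⁻ H e∈C =
      decidable-stable (H i ∈? F) λ Hi∉F → none (i , Hi∉F)

  -- Facets inside the cycle and their place in a shelling

  module _ (reversed : ∀ e → e ∉ C → ∃[ i ] source e ≡ target (H i) × target e ≡ source (H i)) where

    -- `T` avoids the reverse `H r` of `e` because a face has no 2-cycle, and it avoids `H i` and
    -- `H j` because the edges of a face have distinct sources and distinct targets.
    edge-outside-C⇒small : ∀ {S T e} → Face K S → e ∈ S → e ∉ C → T ⊆ S → T ⊆ C → 3 + ∣ T ∣ ≤ ∣ C ∣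
    edge-outside-C⇒small {S} {T} {e} face e∈S e∉C T⊆S T⊆C
      with r , s≡t , t≡s ← reversed e e∉C
         | i , s≡ ← source-H-surjective (source e)
         | j , t≡ ← target-H-surjective (target e) = begin
      3 + ∣ T ∣                        ≤⟨ +-monoʳ-≤ 3 (p⊆q⇒∣p∣≤∣q∣ T⊆) ⟩
      3 + ∣ C - H r - H i - H j ∣      ≤⟨ +-monoʳ-≤ 2 (x∈p⇒∣p-x∣<∣p∣ Hj∈) ⟩
      2 + ∣ C - H r - H i ∣            ≤⟨ +-monoʳ-≤ 1 (x∈p⇒∣p-x∣<∣p∣ Hi∈) ⟩
      1 + ∣ C - H r ∣                  ≤⟨ x∈p⇒∣p-x∣<∣p∣ (∈-image⁺ H r) ⟩
      ∣ C ∣                            ∎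
      where
      open ≤-Reasoning
      open Multipath G face

      -- The three excluded edges are distinct: `i` or `j` equal to `r` would make `H r` a loop, and
      -- `i` equal to `j` would give `H i` both ends of `e`, so that `e` would be in `C`.
      Hi∈ : H i ∈ C - H r
      Hi∈ = x∈p∧x≢y⇒x∈p-y (∈-image⁺ H i) λ eq →
        no-loop r (trans (sym (cong source eq)) (trans s≡ s≡t))

      Hj∈ : H j ∈ C - H r - H i
      Hj∈ = x∈p∧x≢y⇒x∈p-y
        (x∈p∧x≢y⇒x∈p-y (∈-image⁺ H j) λ eq →
          no-loop r (sym (trans (sym (cong target eq)) (trans t≡ t≡s))))
        (λ eq → e∉C (subst (_∈ C) (simple s≡ (trans (cong target (sym eq)) t≡)) (∈-image⁺ H i)))

      Hr∉T : H r ∉ T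
      Hr∉T Hr∈T = no-2-cycle e∈S (T⊆S Hr∈T) s≡t t≡s

      Hi∉T : H i ∉ T
      Hi∉T Hi∈T = e∉C (subst (_∈ C) (source-injective (T⊆S Hi∈T) e∈S s≡) (∈-image⁺ H i))

      Hj∉T : H j ∉ T
      Hj∉T Hj∈T = e∉C (subst (_∈ C) (target-injective (T⊆S Hj∈T) e∈S t≡) (∈-image⁺ H j))

      T⊆ : T ⊆ C - H r - H i - H j
      T⊆ = p⊆q∧x∉p⇒p⊆q-x (p⊆q∧x∉p⇒p⊆q-x (p⊆q∧x∉p⇒p⊆q-x T⊆C Hr∉T) Hi∉T) Hj∉T

    -- Needed for `T` equal to `C - H i`, to see that this face is maximal, and for `T` a ridge
    -- shared by two facets of a shelling.
    large⇒⊆C : ∀ {S T} → Face K S → T ⊆ S → T ⊆ C → ∣ C ∣ ≤ 2 + ∣ T ∣ → S ⊆ C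
    large⇒⊆C face T⊆S T⊆C large {e} e∈S = decidable-stable (e ∈? C) λ e∉C →
      <⇒≱ (edge-outside-C⇒small face e∈S e∉C T⊆S T⊆C) large

    -- A face containing `C - H i` has enough edges of `C` to lie inside `C`, and it cannot contain
    -- `H i` too, as `C` is not a face.
    C-minus-edge-facet : ∀ i → IsMaximalFace K (C - H i)
    C-minus-edge-facet i = C-minus-edge-face i , λ T faceT C-Hi⊆T → ⊆-antisym C-Hi⊆T
      (p⊆q∧x∉p⇒p⊆q-x
        (large⇒⊆C faceT C-Hi⊆T (p─q⊆p C _) (m≤n⇒m≤1+n (∣p∣≤1+∣p-x∣ C (H i))))
        (λ Hi∈T → C-not-face (down K (p-x⊆q∧x∈q⇒p⊆q C-Hi⊆T Hi∈T) faceT)))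

    shelling-nonempty : ∀ {F : Fin 0 → Subset #E} → ¬ IsShelling K F
    shelling-nonempty shelling =
      ¬Fin0 (proj₁ (Equivalence.to (IsShelling.enumerates shelling (C - H zero)) (C-minus-edge-facet zero)))

    -- The goal is decidable, so it suffices to refute its negation. Under the negation, descent on
    -- positions shows that no facet lies in `C`, but `C - H zero` does.
    first-facet⊆C : ∀ {k} {F : Fin (suc k) → Subset #E} → IsShelling K F → F zero ⊆ C
    first-facet⊆C {k} {F} shelling = decidable-stable (F zero ⊆? C) λ F₀⊈C →
      let x , eq = Equivalence.to (enumerates (C - H zero)) (C-minus-edge-facet zero)
      in none F₀⊈C x (FinI.<-wellFounded x) (subst (_⊆ C) (sym eq) (p─q⊆p C _))
      where
      open IsShelling shelling

      none : ¬ (F zero ⊆ C) → ∀ x → Acc Fin._<_ x → ¬ (F x ⊆ C)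
      none F₀⊈C zero      _         F₀⊆C = F₀⊈C F₀⊆C
      none F₀⊈C x@(suc _) (acc rec) Fx⊆C =
        -- The empty face lies in `F x` and in the earlier `F zero`, so purity yields, up to double
        -- negation, a ridge `T` of `F x` inside an earlier `F y`. This ridge forces `F y` into `C`.
        pure⇒¬¬face (⟨ F x ⟩ ∩ᶜ ⋃[ (λ ((i , _) : ∃[ i ] i Fin.< x) → ⟨ F i ⟩) ]) (shells x (s≤s z≤n)) {⊥} (⊥⊆ , (zero , s≤s z≤n) , ⊥⊆)
          λ T (T⊆Fx , (y , y<x) , T⊆Fy) dim≡ →
            none F₀⊈C y (rec y<x) (large⇒⊆C (proj₁ (facet y)) T⊆Fy (Fx⊆C ∘ T⊆Fx) (large T dim≡))
        where
        facet : ∀ y → IsMaximalFace K (F y)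
        facet y = Equivalence.from (enumerates (F y)) (y , refl)

        -- `F x` is `C` without one edge, and its ridge `T` lacks one edge more.
        large : ∀ T → dim T ≡ dim (F x) ℤ.- 1ℤ → ∣ C ∣ ≤ 2 + ∣ T ∣
        large T dim≡ with i , Fx≡ ← facet⊆C⇒≡ (facet x) Fx⊆C = begin
          ∣ C ∣            ≤⟨ ∣p∣≤1+∣p-x∣ C (H i) ⟩
          1 + ∣ C - H i ∣  ≡⟨ cong (suc ∘ ∣_∣) Fx≡ ⟨
          1 + ∣ F x ∣      ≡⟨ cong suc (dim≡dim-1⇒ T (F x) dim≡) ⟩
          2 + ∣ T ∣        ∎
          where open ≤-Reasoning

    first-facet-meets-C : ∀ {k} {F : Fin (suc k) → Subset #E} → IsShelling K F → ∃[ i ] H i ∈ F zero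
    first-facet-meets-C {F = F} shelling =
      let i , F₀≡ = facet⊆C⇒≡ (Equivalence.from (IsShelling.enumerates shelling (F zero)) (zero , refl))
                      (first-facet⊆C shelling)
      -- The edge right after the removed one starts the remaining path, at position `0`.
      in next i , subst (H (next i) ∈_) (sym F₀≡) (Hv∈D i z≤n)

-- The two Hamiltonian cycles of BP

module _ {n : ℕ} (n≥2 : 2 ≤ suc n) where

  open Digraph (BP (suc n) n≥2)

  private
    m : ℕ
    m = suc (suc n)

  -- The edge `m ↑ʳ j` goes from `next j` to `j`, so following the cycle lowers `j`. `opposite`
  -- makes `next` the direction of travel here as well.
  ascending descending : Fin m → Fin #E
  ascending  i = i ↑ˡ m
  descending i = m ↑ʳ opposite i

  source-↑ˡ : ∀ i → source (i ↑ˡ m) ≡ i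
  source-↑ˡ i = cong [ id , next ]′ (splitAt-↑ˡ m i m)

  target-↑ˡ : ∀ i → target (i ↑ˡ m) ≡ next i
  target-↑ˡ i = cong [ next , id ]′ (splitAt-↑ˡ m i m)

  source-↑ʳ : ∀ i → source (m ↑ʳ i) ≡ next i
  source-↑ʳ i = cong [ id , next ]′ (splitAt-↑ʳ m m i)

  target-↑ʳ : ∀ i → target (m ↑ʳ i) ≡ i
  target-↑ʳ i = cong [ next , id ]′ (splitAt-↑ʳ m m i)

  target-ascending : ∀ i → target (ascending i) ≡ source (ascending (next i))
  target-ascending i = trans (target-↑ˡ i) (sym (source-↑ˡ (next i)))

  source-ascending-injective : ∀ {i j} → source (ascending i) ≡ source (ascending j) → i ≡ j
  source-ascending-injective {i} {j} eq = trans (sym (source-↑ˡ i)) (trans eq (source-↑ˡ j))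

  source-ascending-surjective : ∀ v → ∃[ i ] source (ascending i) ≡ v
  source-ascending-surjective v = v , source-↑ˡ v

  target-descending : ∀ i → target (descending i) ≡ source (descending (next i))
  target-descending i = trans (target-↑ʳ (opposite i))
    (trans (sym (opposite-next i)) (sym (source-↑ʳ (opposite (next i)))))

  source-descending-injective : ∀ {i j} → source (descending i) ≡ source (descending j) → i ≡ j
  source-descending-injective {i} {j} eq = begin
    i                      ≡⟨ opposite-involutive i ⟨
    opposite (opposite i)  ≡⟨ cong opposite (next-injective {i = opposite i} {opposite j} next≡) ⟩
    opposite (opposite j)  ≡⟨ opposite-involutive j ⟩
    j                      ∎
    where
    open ≡-Reasoning
    next≡ : next (opposite i) ≡ next (opposite j)
    next≡ = trans (sym (source-↑ʳ (opposite i))) (trans eq (source-↑ʳ (opposite j)))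

  source-descending-surjective : ∀ v → ∃[ i ] source (descending i) ≡ v
  source-descending-surjective v = next (opposite v) ,
    trans (source-↑ʳ (opposite (next (opposite v)))) (trans (opposite-next (opposite v)) (opposite-involutive v))

  module A = HamiltonianCycle (BP (suc n) n≥2) ascending
    target-ascending source-ascending-injective source-ascending-surjective

  module B = HamiltonianCycle (BP (suc n) n≥2) descending
    target-descending source-descending-injective source-descending-surjective

  ascending∉descending : ∀ i → ascending i ∉ B.C
  ascending∉descending i ∈B with j , eq ← ∈-image⁻ descending ∈B
    with () ← trans (sym (splitAt-↑ʳ m m (opposite j))) (trans (cong (splitAt m) eq) (splitAt-↑ˡ m i m))

  A-reversed : ∀ e → e ∉ A.C → ∃[ i ] source e ≡ target (ascending i) × target e ≡ source (ascending i)
  A-reversed e e∉A with splitAt m e in eq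
  ... | inj₁ i = contradiction (subst (_∈ A.C) (splitAt⁻¹-↑ˡ eq) (∈-image⁺ ascending i)) e∉A
  ... | inj₂ i = i , sym (target-↑ˡ i) , sym (source-↑ˡ i)

  B-reversed : ∀ e → e ∉ B.C → ∃[ i ] source e ≡ target (descending i) × target e ≡ source (descending i)
  B-reversed e e∉B with splitAt m e in eq
  ... | inj₁ i = opposite i
               , sym (trans (target-↑ʳ (opposite (opposite i))) (opposite-involutive i))
               , sym (trans (source-↑ʳ (opposite (opposite i))) (cong next (opposite-involutive i)))
  ... | inj₂ i = contradiction
    (subst (_∈ B.C) (trans (cong (m ↑ʳ_) (opposite-involutive i)) (splitAt⁻¹-↑ʳ {m} eq))
      (∈-image⁺ descending (opposite i)))
    e∉B

  no-shelling : ∀ {k} {F : Fin k → Subset #E} → ¬ IsShelling (MultipathComplex (BP (suc n) n≥2)) F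
  no-shelling {zero}  shelling = A.shelling-nonempty A-reversed shelling
  no-shelling {suc k} shelling =
    -- The first facet contains an ascending edge, yet it has to lie in the descending cycle.
    let i , i∈F₀ = A.first-facet-meets-C A-reversed shelling
    in ascending∉descending i (B.first-facet⊆C B-reversed shelling i∈F₀)

proposition3p1 : (n : ℕ) (n≥2 : 2 ≤ n) → ¬ Shellable (MultipathComplex (BP n n≥2))
proposition3p1 (suc n) n≥2 (_ , _ , shelling) = no-shelling n≥2 shelling
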